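{- Let $\mathbb{K}$ be a field and $f=a_0(x)+a_1(x)y+\cdots+a_n(x)y^n\in\mathbb{K}[x,y]$ with $n\geq 2$, $a_0,\ldots,a_n\in\mathbb{K}[x]$, $a_0a_n\neq 0$. Assume that $f$ has no nonconstant factor in $\mathbb{K}[x]$, and let $\nu_0$ and $\nu_n$ be the number of irreducible factors of $a_0(x)$ and $a_n(x)$ in $\mathbb{K}[x]$, respectively, counted with their multiplicities. (i) If $\deg a_0>\max\{\deg a_1,\dots,\deg a_n\}$, then $f$ is a product of at most $\nu_0$ irreducible polynomials over $\mathbb{K}[x]$. (ii) If $\deg a_n>\max\{\deg a_0,\dots,\deg a_{n-1}\}$, then $f$ is a product of at most $\nu_n$ irreducible polynomials over $\mathbb{K}[x]$.
   Context: $f$ is regarded as a polynomial in $y$ with coefficients in $\mathbb{K}[x]$; "a product of at most $k$ irreducible polynomials over $\mathbb{K}[x]$" means that in the factorization of $f$ into irreducible elements of $\mathbb{K}[x][y]$ the number of factors, counted with multiplicities, is at most $k$. -}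

module Defs where

open import Algebra.Bundles using (CommutativeRing; Semiring)
import Algebra.Definitions
import Algebra.Definitions.RawSemiring
open import Axiom.ExcludedMiddle using (ExcludedMiddle)
open import Data.List.Base using (List; []; _∷_; map)
import Data.List.Extrema
open import Data.Nat.Base as ℕ using (ℕ; zero; suc)
open import Data.Nat.Properties using (≤-isTotalOrder)
open import Data.Product.Base using (∃-syntax; _×_; _,_)
open import Data.Vec.Functional using (Vector; toList)
open import Level using (Level; 0ℓ; _⊔_; Lift; lift; lower)
open import Relation.Binary.Bundles using (TotalOrder)
open import Relation.Binary.Construct.Add.Infimum.NonStrict ℕ._≤_ using (≤₋-isTotalOrder-≡)
open import Relation.Binary.Construct.Add.Infimum.Strict ℕ._<_ public using () renaming (_<₋_ to _<ᵈ_)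
import Relation.Binary.Reasoning.Setoid as SetoidReasoning
open import Relation.Binary.Structures using (IsEquivalence)
open import Relation.Nullary.Construct.Add.Infimum using (_₋; ⊥₋; [_])
open import Relation.Nullary.Decidable.Core using (Dec; yes; no; map′)
open import Relation.Nullary.Negation.Core using (¬_)

private
  variable
    c ℓ : Level

-- The standard library only has Heyting fields, whose apartness relation
-- is extra data; this is the classical notion, on the underlying equality.
record IsField (R : CommutativeRing c ℓ) : Set (c ⊔ ℓ) where
  open CommutativeRing R
  open Algebra.Definitions _≈_ using (Invertible)
  field
    1≉0        : ¬ 1# ≈ 0#
    invertible : ∀ x → ¬ x ≈ 0# → Invertible 1# _*_ x

module Factorization (R : CommutativeRing c ℓ) where
  open CommutativeRing R
  open Algebra.Definitions.RawSemiring (Semiring.rawSemiring semiring) public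
    using (_∣_; Irreducible; product)

  -- x is a unit times a product of m irreducibles.  In a unique
  -- factorization domain such an m is determined by x, and is the number
  -- of irreducible factors of x counted with multiplicity (0 for units).
  HasFactorCount : Carrier → ℕ → Set (c ⊔ ℓ)
  HasFactorCount x m =
    ∃[ u ] ∃[ ps ] u ∣ 1# × (∀ i → Irreducible (ps i)) × x ≈ u * product {m} ps

  -- The second component says that the bound holds for every factorization
  -- of x, so that nothing depends on uniqueness of factorization in R.
  ProductOfAtMost : ℕ → Carrier → Set (c ⊔ ℓ)
  ProductOfAtMost k x =
    (∃[ m ] m ℕ.≤ k ×
      (∃[ ps ] (∀ i → Irreducible (ps i)) × x ≈ product {m} ps))
    × (∀ m → HasFactorCount x m → m ℕ.≤ k)

-- ⊥₋ plays the role of -∞, the degree of the zero polynomial.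
Degree : Set
Degree = ℕ ₋

degreeOrder : TotalOrder 0ℓ 0ℓ 0ℓ
degreeOrder = record { isTotalOrder = ≤₋-isTotalOrder-≡ ≤-isTotalOrder }

maximum : ∀ {m} → Vector Degree m → Degree
maximum ds = Data.List.Extrema.max degreeOrder ⊥₋ (toList ds)

module Polynomial (R : CommutativeRing c ℓ) where
  open CommutativeRing R
  open import Algebra.Properties.Ring ring using (-0#≈0#)
  open SetoidReasoning setoid

  -- Lists of coefficients, constant term first; trailing zeros are allowed.
  Poly : Set c
  Poly = List Carrier

  coeff : Poly → ℕ → Carrier
  coeff []      _       = 0#
  coeff (a ∷ p) zero    = a
  coeff (a ∷ p) (suc i) = coeff p i

  infix 4 _≈ᴾ_
  record _≈ᴾ_ (p q : Poly) : Set ℓ where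
    constructor coeffs-≈
    field
      at : ∀ i → coeff p i ≈ coeff q i
  open _≈ᴾ_ public

  infixl 6 _+ᴾ_
  infixl 7 _*ᴾ_ _·_

  _+ᴾ_ : Poly → Poly → Poly
  []      +ᴾ q       = q
  (a ∷ p) +ᴾ []      = a ∷ p
  (a ∷ p) +ᴾ (b ∷ q) = a + b ∷ p +ᴾ q

  -ᴾ_ : Poly → Poly
  -ᴾ_ = map (-_)

  _·_ : Carrier → Poly → Poly
  a · p = map (a *_) p

  -- (a + X p) q = a q + X (p q)
  _*ᴾ_ : Poly → Poly → Poly
  []      *ᴾ q = []
  (a ∷ p) *ᴾ q = a · q +ᴾ (0# ∷ p *ᴾ q)

  const : Carrier → Poly
  const a = a ∷ []

  ≈ᴾ-isEquivalence : IsEquivalence _≈ᴾ_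
  ≈ᴾ-isEquivalence = record
    { refl  = coeffs-≈ λ _ → refl
    ; sym   = λ e → coeffs-≈ λ i → sym (at e i)
    ; trans = λ e f → coeffs-≈ λ i → trans (at e i) (at f i)
    }

  private
    module E = IsEquivalence ≈ᴾ-isEquivalence

  coeff-+ : ∀ p q i → coeff (p +ᴾ q) i ≈ coeff p i + coeff q i
  coeff-+ []      q       i       = sym (+-identityˡ _)
  coeff-+ (a ∷ p) []      i       = sym (+-identityʳ _)
  coeff-+ (a ∷ p) (b ∷ q) zero    = refl
  coeff-+ (a ∷ p) (b ∷ q) (suc i) = coeff-+ p q i

  coeff-· : ∀ a p i → coeff (a · p) i ≈ a * coeff p i
  coeff-· a []      i       = sym (zeroʳ a)
  coeff-· a (b ∷ p) zero    = refl
  coeff-· a (b ∷ p) (suc i) = coeff-· a p i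

  coeff-neg : ∀ p i → coeff (-ᴾ p) i ≈ - coeff p i
  coeff-neg []      i       = sym -0#≈0#
  coeff-neg (a ∷ p) zero    = refl
  coeff-neg (a ∷ p) (suc i) = coeff-neg p i

  ∷-cong : ∀ {a b p q} → a ≈ b → p ≈ᴾ q → a ∷ p ≈ᴾ b ∷ q
  ∷-cong e f .at zero    = e
  ∷-cong e f .at (suc i) = at f i

  0∷[] : 0# ∷ [] ≈ᴾ []
  0∷[] .at zero    = refl
  0∷[] .at (suc i) = refl

  +ᴾ-cong : ∀ {p p′ q q′} → p ≈ᴾ p′ → q ≈ᴾ q′ → p +ᴾ q ≈ᴾ p′ +ᴾ q′
  +ᴾ-cong {p} {p′} {q} {q′} e f .at i = begin
    coeff (p +ᴾ q) i        ≈⟨ coeff-+ p q i ⟩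
    coeff p i + coeff q i   ≈⟨ +-cong (at e i) (at f i) ⟩
    coeff p′ i + coeff q′ i ≈⟨ coeff-+ p′ q′ i ⟨
    coeff (p′ +ᴾ q′) i      ∎

  +ᴾ-comm : ∀ p q → p +ᴾ q ≈ᴾ q +ᴾ p
  +ᴾ-comm p q .at i = begin
    coeff (p +ᴾ q) i      ≈⟨ coeff-+ p q i ⟩
    coeff p i + coeff q i ≈⟨ +-comm _ _ ⟩
    coeff q i + coeff p i ≈⟨ coeff-+ q p i ⟨
    coeff (q +ᴾ p) i      ∎

  +ᴾ-assoc : ∀ p q r → (p +ᴾ q) +ᴾ r ≈ᴾ p +ᴾ (q +ᴾ r)
  +ᴾ-assoc p q r .at i = begin
    coeff ((p +ᴾ q) +ᴾ r) i             ≈⟨ coeff-+ (p +ᴾ q) r i ⟩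
    coeff (p +ᴾ q) i + coeff r i        ≈⟨ +-congʳ (coeff-+ p q i) ⟩
    coeff p i + coeff q i + coeff r i   ≈⟨ +-assoc _ _ _ ⟩
    coeff p i + (coeff q i + coeff r i) ≈⟨ +-congˡ (coeff-+ q r i) ⟨
    coeff p i + coeff (q +ᴾ r) i        ≈⟨ coeff-+ p (q +ᴾ r) i ⟨
    coeff (p +ᴾ (q +ᴾ r)) i             ∎

  +ᴾ-identityʳ : ∀ p → p +ᴾ [] ≈ᴾ p
  +ᴾ-identityʳ p = +ᴾ-comm p []

  -ᴾ-inverseˡ : ∀ p → (-ᴾ p) +ᴾ p ≈ᴾ []
  -ᴾ-inverseˡ p .at i =
    trans (coeff-+ (-ᴾ p) p i) (trans (+-congʳ (coeff-neg p i)) (-‿inverseˡ (coeff p i)))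

  -ᴾ-cong : ∀ {p q} → p ≈ᴾ q → -ᴾ p ≈ᴾ -ᴾ q
  -ᴾ-cong {p} {q} e .at i =
    trans (coeff-neg p i) (trans (-‿cong (at e i)) (sym (coeff-neg q i)))

  +ᴾ-interchange : ∀ p q r s → (p +ᴾ q) +ᴾ (r +ᴾ s) ≈ᴾ (p +ᴾ r) +ᴾ (q +ᴾ s)
  +ᴾ-interchange p q r s = E.trans (+ᴾ-assoc p q (r +ᴾ s)) (E.trans (+ᴾ-cong (E.refl {p}) inner) (E.sym (+ᴾ-assoc p r (q +ᴾ s))))
    where
    inner : q +ᴾ (r +ᴾ s) ≈ᴾ r +ᴾ (q +ᴾ s)
    inner = E.trans (E.sym (+ᴾ-assoc q r s)) (E.trans (+ᴾ-cong (+ᴾ-comm q r) E.refl) (+ᴾ-assoc r q s))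

  ·-cong : ∀ {a b p q} → a ≈ b → p ≈ᴾ q → a · p ≈ᴾ b · q
  ·-cong {a} {b} {p} {q} e f .at i =
    trans (coeff-· a p i) (trans (*-cong e (at f i)) (sym (coeff-· b q i)))

  ·-distribˡ : ∀ a p q → a · (p +ᴾ q) ≈ᴾ a · p +ᴾ a · q
  ·-distribˡ a p q .at i = begin
    coeff (a · (p +ᴾ q)) i            ≈⟨ coeff-· a (p +ᴾ q) i ⟩
    a * coeff (p +ᴾ q) i              ≈⟨ *-congˡ (coeff-+ p q i) ⟩
    a * (coeff p i + coeff q i)       ≈⟨ distribˡ _ _ _ ⟩
    a * coeff p i + a * coeff q i     ≈⟨ +-cong (coeff-· a p i) (coeff-· a q i) ⟨
    coeff (a · p) i + coeff (a · q) i ≈⟨ coeff-+ (a · p) (a · q) i ⟨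
    coeff (a · p +ᴾ a · q) i          ∎

  ·-assoc : ∀ a b p → a · (b · p) ≈ᴾ (a * b) · p
  ·-assoc a b p .at i = begin
    coeff (a · (b · p)) i ≈⟨ coeff-· a (b · p) i ⟩
    a * coeff (b · p) i   ≈⟨ *-congˡ (coeff-· b p i) ⟩
    a * (b * coeff p i)   ≈⟨ *-assoc _ _ _ ⟨
    a * b * coeff p i     ≈⟨ coeff-· (a * b) p i ⟨
    coeff ((a * b) · p) i ∎

  1·p : ∀ p → 1# · p ≈ᴾ p
  1·p p .at i = trans (coeff-· 1# p i) (*-identityˡ _)

  0·p : ∀ p → 0# · p ≈ᴾ []
  0·p p .at i = trans (coeff-· 0# p i) (zeroˡ _)

  0∷-+ : ∀ p q → 0# ∷ p +ᴾ q ≈ᴾ (0# ∷ p) +ᴾ (0# ∷ q)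
  0∷-+ p q = ∷-cong (sym (+-identityˡ 0#)) E.refl

  *ᴾ-congˡ : ∀ p {q r} → q ≈ᴾ r → p *ᴾ q ≈ᴾ p *ᴾ r
  *ᴾ-congˡ []      e = E.refl
  *ᴾ-congˡ (a ∷ p) e = +ᴾ-cong (·-cong refl e) (∷-cong refl (*ᴾ-congˡ p e))

  *ᴾ-distribˡ : ∀ p q r → p *ᴾ (q +ᴾ r) ≈ᴾ p *ᴾ q +ᴾ p *ᴾ r
  *ᴾ-distribˡ []      q r = E.refl
  *ᴾ-distribˡ (a ∷ p) q r = E.trans
    (+ᴾ-cong (·-distribˡ a q r)
      (E.trans (∷-cong refl (*ᴾ-distribˡ p q r)) (0∷-+ (p *ᴾ q) (p *ᴾ r))))
    (+ᴾ-interchange (a · q) (a · r) (0# ∷ p *ᴾ q) (0# ∷ p *ᴾ r))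

  *ᴾ-zeroʳ : ∀ p → p *ᴾ [] ≈ᴾ []
  *ᴾ-zeroʳ []      = E.refl
  *ᴾ-zeroʳ (a ∷ p) = E.trans (∷-cong refl (*ᴾ-zeroʳ p)) 0∷[]

  *ᴾ-∷ : ∀ p b q → p *ᴾ (b ∷ q) ≈ᴾ b · p +ᴾ (0# ∷ p *ᴾ q)
  *ᴾ-∷ []      b q = E.sym 0∷[]
  *ᴾ-∷ (a ∷ p) b q = ∷-cong (+-congʳ (*-comm a b)) (E.trans
    (+ᴾ-cong (E.refl {a · q}) (*ᴾ-∷ p b q)) (E.trans
    (E.sym (+ᴾ-assoc (a · q) (b · p) _)) (E.trans
    (+ᴾ-cong (+ᴾ-comm (a · q) (b · p)) E.refl)
    (+ᴾ-assoc (b · p) (a · q) _))))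

  *ᴾ-comm : ∀ p q → p *ᴾ q ≈ᴾ q *ᴾ p
  *ᴾ-comm []      q = E.sym (*ᴾ-zeroʳ q)
  *ᴾ-comm (a ∷ p) q = E.trans
    (+ᴾ-cong (E.refl {a · q}) (∷-cong refl (*ᴾ-comm p q))) (E.sym (*ᴾ-∷ q a p))

  *ᴾ-cong : ∀ {p p′ q q′} → p ≈ᴾ p′ → q ≈ᴾ q′ → p *ᴾ q ≈ᴾ p′ *ᴾ q′
  *ᴾ-cong {p} {p′} {q} {q′} e f =
    E.trans (*ᴾ-congˡ p f) (E.trans (*ᴾ-comm p q′) (E.trans (*ᴾ-congˡ q′ e) (*ᴾ-comm q′ p′)))

  *ᴾ-distribʳ : ∀ p q r → (q +ᴾ r) *ᴾ p ≈ᴾ q *ᴾ p +ᴾ r *ᴾ p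
  *ᴾ-distribʳ p q r = E.trans (*ᴾ-comm (q +ᴾ r) p)
    (E.trans (*ᴾ-distribˡ p q r) (+ᴾ-cong (*ᴾ-comm p q) (*ᴾ-comm p r)))

  ·-*ᴾ : ∀ a p q → (a · p) *ᴾ q ≈ᴾ a · (p *ᴾ q)
  ·-*ᴾ a []      q = E.refl
  ·-*ᴾ a (b ∷ p) q = E.trans
    (+ᴾ-cong (E.sym (·-assoc a b q)) (∷-cong (sym (zeroʳ a)) (·-*ᴾ a p q)))
    (E.sym (·-distribˡ a (b · q) (0# ∷ p *ᴾ q)))

  0∷-*ᴾ : ∀ p q → (0# ∷ p) *ᴾ q ≈ᴾ 0# ∷ p *ᴾ q
  0∷-*ᴾ p q = +ᴾ-cong (0·p q) E.refl

  *ᴾ-assoc : ∀ p q r → (p *ᴾ q) *ᴾ r ≈ᴾ p *ᴾ (q *ᴾ r)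
  *ᴾ-assoc []      q r = E.refl
  *ᴾ-assoc (a ∷ p) q r = E.trans
    (*ᴾ-distribʳ r (a · q) (0# ∷ p *ᴾ q))
    (+ᴾ-cong (·-*ᴾ a q r) (E.trans (0∷-*ᴾ (p *ᴾ q) r) (∷-cong refl (*ᴾ-assoc p q r))))

  *ᴾ-identityˡ : ∀ p → const 1# *ᴾ p ≈ᴾ p
  *ᴾ-identityˡ p = E.trans (+ᴾ-cong (1·p p) 0∷[]) (+ᴾ-identityʳ p)

  polynomialRing : CommutativeRing c ℓ
  polynomialRing = record
    { Carrier = Poly
    ; _≈_     = _≈ᴾ_
    ; _+_     = _+ᴾ_
    ; _*_     = _*ᴾ_
    ; -_      = -ᴾ_
    ; 0#      = []
    ; 1#      = const 1#
    ; isCommutativeRing = record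
      { isRing = record
        { +-isAbelianGroup = record
          { isGroup = record
            { isMonoid = record
              { isSemigroup = record
                { isMagma = record { isEquivalence = ≈ᴾ-isEquivalence ; ∙-cong = +ᴾ-cong }
                ; assoc   = +ᴾ-assoc
                }
              ; identity = (λ p → E.refl) , +ᴾ-identityʳ
              }
            ; inverse = -ᴾ-inverseˡ , (λ p → E.trans (+ᴾ-comm p (-ᴾ p)) (-ᴾ-inverseˡ p))
            ; ⁻¹-cong = -ᴾ-cong
            }
          ; comm = +ᴾ-comm
          }
        ; *-cong     = *ᴾ-cong
        ; *-assoc    = *ᴾ-assoc
        ; *-identity = *ᴾ-identityˡ , (λ p → E.trans (*ᴾ-comm p (const 1#)) (*ᴾ-identityˡ p))
        ; distrib    = *ᴾ-distribˡ , *ᴾ-distribʳ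
        }
      ; *-comm = *ᴾ-comm
      }
    }

  -- Excluded middle is used to decide which coefficients vanish.
  module _ (em : ExcludedMiddle (c ⊔ ℓ)) where

    isZero? : ∀ a → Dec (a ≈ 0#)
    isZero? a = map′ lower lift (em {P = Lift c (a ≈ 0#)})

    extendDeg : ∀ {a} → Dec (a ≈ 0#) → Degree → Degree
    extendDeg _       [ d ] = [ suc d ]
    extendDeg (yes _) ⊥₋    = ⊥₋
    extendDeg (no _)  ⊥₋    = [ 0 ]

    deg : Poly → Degree
    deg []      = ⊥₋
    deg (a ∷ p) = extendDeg (isZero? a) (deg p)

    Nonconstant : Poly → Set
    Nonconstant p = [ 0 ] <ᵈ deg p

-- Thus R [X] [X] is R[x][y]: the list a₀ ∷ a₁ ∷ ⋯ of polynomials in x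
-- stands for a₀(x) + a₁(x) y + ⋯.
infix 8 _[X]

_[X] : CommutativeRing c ℓ → CommutativeRing c ℓ
R [X] = Polynomial.polynomialRing R

{-# OPTIONS --safe #-}
-- Let N = deg_x f.  The hypothesis of (i) or (ii) says that the coefficient of
-- x^N in f, a polynomial in y, is a single monomial of y-degree 0 or n.  Such
-- coefficients multiply and K is a domain, so every factor g of f inherits the
-- property: its x-leading part sits in its constant, respectively leading,
-- coefficient b.  If b is a unit of K[x], then g has x-degree 0 and hence is
-- itself a monomial in y, and a unit because y does not divide f.  Thus a
-- product of m nonunits equal to f induces a product of m nonunits equal to a₀
-- or aₙ, and in the factorial ring K[x] such a product has at most ν₀ or νₙ
-- factors.  The same bound makes repeated splitting of f terminate.
module Submission where

open import Defs
open import Algebra.Bundles using (CommutativeRing)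
import Algebra.Properties.CommutativeSemigroup as CommutativeSemigroupProperties
import Algebra.Properties.CommutativeSemigroup.Divisibility as SemigroupDivisibility
import Algebra.Properties.Ring as RingProperties
import Algebra.Properties.Semiring.Divisibility as SemiringDivisibility
import Algebra.Properties.Semiring.Primality as Primality
open import Axiom.ExcludedMiddle using (ExcludedMiddle)
open import Data.Empty using (⊥-elim)
open import Data.Fin.Base using (zero; suc)
open import Data.List.Base using ([]; _∷_; map)
open import Data.List.Extrema degreeOrder using (xs≤max)
open import Data.List.Relation.Unary.All.Properties using (tabulate⁻)
open import Data.Nat.Base as ℕ using (ℕ; zero; suc; pred; _≤_; _<_; z≤n; s≤s)
import Data.Nat.Properties as ℕ
open import Data.Product.Base using (∃; ∃-syntax; _×_; _,_; proj₁; proj₂)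
open import Data.Sum.Base using (_⊎_; inj₁; inj₂)
open import Data.Vec.Functional as Vec using (Vector; toList; head; last; tail; init)
open import Function.Base using (_∘_)
open import Level using (Level; _⊔_)
open import Relation.Binary.Definitions using (tri<; tri≈; tri>)
open import Relation.Binary.PropositionalEquality.Core as ≡ using (_≡_; _≢_)
open import Relation.Binary.Construct.Add.Infimum.NonStrict ℕ._≤_ using (_≤₋_; [_])
open import Relation.Binary.Construct.Add.Infimum.Strict ℕ._<_ using ([_])
import Relation.Binary.Reasoning.Setoid as SetoidReasoning
open import Relation.Nullary.Construct.Add.Infimum using (⊥₋; [_])
open import Relation.Nullary.Decidable.Core using (Dec; yes; no)
open import Relation.Nullary.Negation.Core using (¬_; contradiction)

private
  variable
    c ℓ : Level

-- Comparing the summands of equal sums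

sum-balance : ∀ {i j m n} → i ℕ.+ j ≡ m ℕ.+ n → i < m → n < j
sum-balance eq i<m = ℕ.≰⇒> λ j≤n → ℕ.<-irrefl eq (ℕ.+-mono-<-≤ i<m j≤n)

pred≤⇒≤suc : ∀ {m n} → pred m ≤ n → m ≤ suc n
pred≤⇒≤suc {zero}  _   = z≤n
pred≤⇒≤suc {suc m} m≤n = s≤s m≤n

-- A strict inequality in one summand would separate the sums. This is how additivity of degrees and
-- orders turns an equality for a product into equalities for both factors.
summands-≡ : ∀ {i j m n} → i ≤ m → j ≤ n → m ℕ.+ n ≡ i ℕ.+ j → i ≡ m × j ≡ n
summands-≡ {i} {j} {m} {n} i≤m j≤n eq = 
  i≡m , ℕ.+-cancelˡ-≡ i j n (≡.trans (≡.sym eq) (≡.cong (ℕ._+ n) (≡.sym i≡m)))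
  where
  i≡m : i ≡ m
  i≡m = ℕ.≤-antisym i≤m (ℕ.≮⇒≥ λ i<m → ℕ.<-irrefl (≡.sym eq) (ℕ.+-mono-<-≤ i<m j≤n))

Integral : CommutativeRing c ℓ → Set (c ⊔ ℓ)
Integral R = ∀ a b → a * b ≈ 0# → a ≈ 0# ⊎ b ≈ 0#
  where open CommutativeRing R

-- Coefficients of products and of coefficient vectors

module Coefficients (R : CommutativeRing c ℓ) where
  open CommutativeRing R using (Carrier; _≈_; _+_; _*_; 0#; setoid; refl; sym; trans; zeroˡ; zeroʳ; *-congʳ; *-congˡ;
    +-cong; +-congˡ; +-congʳ; +-identityˡ; +-identityʳ)
  open Polynomial R
  open SetoidReasoning setoid

  VanishesFrom : ℕ → Poly → Set ℓ
  VanishesFrom n p = ∀ i → n ≤ i → coeff p i ≈ 0#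

  VanishesBelow : ℕ → Poly → Set ℓ
  VanishesBelow n p = ∀ i → i < n → coeff p i ≈ 0#

  coeff-*-zero : ∀ a p q → coeff ((a ∷ p) *ᴾ q) 0 ≈ a * coeff q 0
  coeff-*-zero a p q = trans (coeff-+ (a · q) (0# ∷ p *ᴾ q) 0)
    (trans (+-identityʳ _) (coeff-· a q 0))

  coeff-*-suc : ∀ a p q k →
    coeff ((a ∷ p) *ᴾ q) (suc k) ≈ a * coeff q (suc k) + coeff (p *ᴾ q) k
  coeff-*-suc a p q k = trans (coeff-+ (a · q) (0# ∷ p *ᴾ q) (suc k))
    (+-congʳ (coeff-· a q (suc k)))

  coeff-*-vanish : ∀ p q k → (∀ i j → i ℕ.+ j ≡ k → coeff p i * coeff q j ≈ 0#) →
    coeff (p *ᴾ q) k ≈ 0#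
  coeff-*-vanish []      q k       h = refl
  coeff-*-vanish (a ∷ p) q zero    h = trans (coeff-*-zero a p q) (h 0 0 ≡.refl)
  coeff-*-vanish (a ∷ p) q (suc k) h = begin
    coeff ((a ∷ p) *ᴾ q) (suc k)             ≈⟨ coeff-*-suc a p q k ⟩
    a * coeff q (suc k) + coeff (p *ᴾ q) k   ≈⟨ +-cong (h 0 (suc k) ≡.refl)
      (coeff-*-vanish p q k λ i j eq → h (suc i) j (≡.cong suc eq)) ⟩
    0# + 0#                                  ≈⟨ +-identityˡ 0# ⟩
    0#                                       ∎

  -- The hypothesis speaks of products of coefficients because on one side of `m` it is `p` that
  -- vanishes and on the other side `q`. In this form it yields the top and the bottom coefficient
  -- alike.
  coeff-*-single : ∀ p q m n →
    (∀ i j → i ℕ.+ j ≡ m ℕ.+ n → i ≢ m → coeff p i * coeff q j ≈ 0#) →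
    coeff (p *ᴾ q) (m ℕ.+ n) ≈ coeff p m * coeff q n
  coeff-*-single []      q m       n       h = sym (zeroˡ _)
  coeff-*-single (a ∷ p) q zero    zero    h = coeff-*-zero a p q
  coeff-*-single (a ∷ p) q zero    (suc n) h = begin
    coeff ((a ∷ p) *ᴾ q) (suc n)             ≈⟨ coeff-*-suc a p q n ⟩
    a * coeff q (suc n) + coeff (p *ᴾ q) n   ≈⟨ +-congˡ (coeff-*-vanish p q n
      λ i j eq → h (suc i) j (≡.cong suc eq) λ ()) ⟩
    a * coeff q (suc n) + 0#                 ≈⟨ +-identityʳ _ ⟩
    a * coeff q (suc n)                      ∎
  coeff-*-single (a ∷ p) q (suc m) n       h = begin
    coeff ((a ∷ p) *ᴾ q) (suc (m ℕ.+ n))                 ≈⟨ coeff-*-suc a p q (m ℕ.+ n) ⟩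
    a * coeff q (suc (m ℕ.+ n)) + coeff (p *ᴾ q) (m ℕ.+ n) ≈⟨ +-cong (h 0 (suc (m ℕ.+ n)) ≡.refl λ ())
      (coeff-*-single p q m n λ i j eq i≢m →
        h (suc i) j (≡.cong suc eq) (i≢m ∘ ℕ.suc-injective)) ⟩
    0# + coeff p m * coeff q n                         ≈⟨ +-identityˡ _ ⟩
    coeff p m * coeff q n                              ∎

  coeff-*-top : ∀ p q m n → VanishesFrom (suc m) p → VanishesFrom (suc n) q →
    coeff (p *ᴾ q) (m ℕ.+ n) ≈ coeff p m * coeff q n
  coeff-*-top p q m n hp hq = coeff-*-single p q m n off
    where
    off : ∀ i j → i ℕ.+ j ≡ m ℕ.+ n → i ≢ m → coeff p i * coeff q j ≈ 0#
    off i j eq i≢m with ℕ.<-cmp i m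
    ... | tri< i<m _ _ = trans (*-congˡ (hq j (sum-balance eq i<m))) (zeroʳ _)
    ... | tri≈ _ i≡m _ = contradiction i≡m i≢m
    ... | tri> _ _ m<i = trans (*-congʳ (hp i m<i)) (zeroˡ _)

  coeff-*-bottom : ∀ p q m n → VanishesBelow m p → VanishesBelow n q →
    coeff (p *ᴾ q) (m ℕ.+ n) ≈ coeff p m * coeff q n
  coeff-*-bottom p q m n hp hq = coeff-*-single p q m n off
    where
    off : ∀ i j → i ℕ.+ j ≡ m ℕ.+ n → i ≢ m → coeff p i * coeff q j ≈ 0#
    off i j eq i≢m with ℕ.<-cmp i m
    ... | tri< i<m _ _ = trans (*-congʳ (hp i i<m)) (zeroˡ _)
    ... | tri≈ _ i≡m _ = contradiction i≡m i≢m
    ... | tri> _ _ m<i = trans (*-congˡ (hq j (sum-balance (≡.sym eq) m<i))) (zeroʳ _)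

  -- `P 0#` covers the indices past the end, where `coeff` returns its default.
  coeff-toList : ∀ {p} {P : Carrier → Set p} {n} (a : Vector Carrier n) → P 0# → (∀ j → P (a j)) →
    ∀ i → P (coeff (toList a) i)
  coeff-toList {n = zero}  a P0 Pa i       = P0
  coeff-toList {n = suc n} a P0 Pa zero    = Pa zero
  coeff-toList {P = P} {suc n} a P0 Pa (suc i) = coeff-toList {P = P} (tail a) P0 (Pa ∘ suc) i

  coeff-toList-last : ∀ {n} (a : Vector Carrier (suc n)) → coeff (toList a) n ≡ last a
  coeff-toList-last {zero}  a = ≡.refl
  coeff-toList-last {suc n} a = coeff-toList-last (tail a)

  coeff-toList-init : ∀ {p} {P : Carrier → Set p} {n} (a : Vector Carrier (suc n)) → P 0# →
    (∀ j → P (init a j)) → ∀ i → i ≢ n → P (coeff (toList a) i)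
  coeff-toList-init {n = zero}  a P0 Pa zero    i≢n = contradiction ≡.refl i≢n
  coeff-toList-init {n = zero}  a P0 Pa (suc i) i≢n = P0
  coeff-toList-init {n = suc n} a P0 Pa zero    i≢n = Pa zero
  coeff-toList-init {P = P} {suc n} a P0 Pa (suc i) i≢n =
    coeff-toList-init {P = P} (tail a) P0 (Pa ∘ suc) i (i≢n ∘ ≡.cong suc)

  toList-vanishes : ∀ {n} (a : Vector Carrier n) → VanishesFrom n (toList a)
  toList-vanishes {zero}  a i       _         = refl
  toList-vanishes {suc n} a (suc i) (s≤s n≤i) = toList-vanishes (tail a) i n≤i

-- Degree, order and monomials over an integral domain

module Domain (R : CommutativeRing c ℓ) (em : ExcludedMiddle (c ⊔ ℓ)) (integral : Integral R) where
  private module R[X] = CommutativeRing (R [X])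
  open CommutativeRing R using (_≈_; _≉_; _*_; 0#; 1#; refl; sym; trans)
  open Polynomial R
  open Coefficients R public
  open Factorization (R [X]) using (_∣_)
  open SemiringDivisibility R[X].semiring using (_,_)

  *-≉0 : ∀ {a b} → a ≉ 0# → b ≉ 0# → a * b ≉ 0#
  *-≉0 {a} {b} a≉0 b≉0 ab≈0 with integral a b ab≈0
  ... | inj₁ a≈0 = a≉0 a≈0
  ... | inj₂ b≈0 = b≉0 b≈0

  IsDegree IsOrder IsMonomial : Poly → ℕ → Set ℓ
  IsDegree   p n = coeff p n ≉ 0# × VanishesFrom (suc n) p
  IsOrder    p n = coeff p n ≉ 0# × VanishesBelow n p
  IsMonomial p n = coeff p n ≉ 0# × (∀ i → i ≢ n → coeff p i ≈ 0#)

  IsDegree⇒≤ : ∀ {p n i} → IsDegree p n → coeff p i ≉ 0# → i ≤ n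
  IsDegree⇒≤ (_ , above) pᵢ≉0 = ℕ.≮⇒≥ λ n<i → pᵢ≉0 (above _ n<i)

  IsOrder⇒≤ : ∀ {p n i} → IsOrder p n → coeff p i ≉ 0# → n ≤ i
  IsOrder⇒≤ (_ , below) pᵢ≉0 = ℕ.≮⇒≥ λ i<n → pᵢ≉0 (below _ i<n)

  IsMonomial⇒≡ : ∀ {p n i} → IsMonomial p n → coeff p i ≉ 0# → i ≡ n
  IsMonomial⇒≡ {n = n} {i} (_ , away) pᵢ≉0 with i ℕ.≟ n
  ... | yes i≡n = i≡n
  ... | no  i≢n = contradiction (away i i≢n) pᵢ≉0

  IsMonomial-resp : ∀ {p q n} → p ≈ᴾ q → IsMonomial p n → IsMonomial q n
  IsMonomial-resp {n = n} e (pₙ≉0 , away) =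
    (λ qₙ≈0 → pₙ≉0 (trans (at e n) qₙ≈0)) , λ i i≢n → trans (sym (at e i)) (away i i≢n)

  DegreeSpec : Poly → Degree → Set ℓ
  DegreeSpec p ⊥₋    = p ≈ᴾ []
  DegreeSpec p [ n ] = IsDegree p n

  -- All later facts about `deg` come from this specification, which hides the appeals to excluded
  -- middle made inside `deg`.
  deg-spec : ∀ p → DegreeSpec p (deg em p)
  deg-spec [] = coeffs-≈ λ _ → refl
  deg-spec (a ∷ p) with isZero? em a | deg em p | deg-spec p
  ... | _       | [ n ] | pₙ≉0 , above = pₙ≉0 , λ { (suc i) (s≤s n<i) → above i n<i }
  ... | no a≉0  | ⊥₋    | p≈0 = a≉0 , λ { (suc i) _ → at p≈0 i }
  ... | yes a≈0 | ⊥₋    | p≈0 = coeffs-≈ λ { zero → a≈0 ; (suc i) → at p≈0 i }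

  degree? : ∀ p → p ≈ᴾ [] ⊎ ∃ (IsDegree p)
  degree? p with deg em p | deg-spec p
  ... | ⊥₋    | p≈0  = inj₁ p≈0
  ... | [ n ] | degₙ = inj₂ (n , degₙ)

  deg-bound : ∀ p {d N} → deg em p ≤₋ d → d <ᵈ [ N ] → VanishesFrom N p
  deg-bound p p≤d d<N i N≤i with deg em p | deg-spec p
  ... | ⊥₋ | p≈0 = at p≈0 i
  deg-bound p [ n≤m ] [ m<N ] i N≤i | [ n ] | _ , above =
    above i (ℕ.≤-trans (ℕ.≤-trans (s≤s n≤m) m<N) N≤i)

  -- Nothing lies below `⊥₋`, so the strict inequality alone makes `l` nonzero and provides its
  -- degree `N`. Each `b j` has degree at most the maximum, hence below `N`.
  maximum-deg : ∀ {m} (b : Vector Poly m) l → maximum (deg em ∘ b) <ᵈ deg em l →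
    ∃[ N ] IsDegree l N × (∀ j → VanishesFrom N (b j))
  maximum-deg b l max< with deg em l | deg-spec l
  maximum-deg b l () | ⊥₋ | _
  ... | [ N ] | degₙ = N , degₙ , λ j →
    deg-bound (b j) (tabulate⁻ (xs≤max ⊥₋ (toList (deg em ∘ b))) j) max<

  order? : ∀ p → p ≈ᴾ [] ⊎ ∃ (IsOrder p)
  order? [] = inj₁ (coeffs-≈ λ _ → refl)
  order? (a ∷ p) with isZero? em a | order? p
  ... | no a≉0  | _ = inj₂ (0 , a≉0 , λ _ ())
  ... | yes a≈0 | inj₂ (n , pₙ≉0 , below) = inj₂ (suc n , pₙ≉0 ,
    λ { zero _ → a≈0 ; (suc i) (s≤s i<n) → below i i<n })
  ... | yes a≈0 | inj₁ p≈0 = inj₁ (coeffs-≈ λ { zero → a≈0 ; (suc i) → at p≈0 i })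

  coeff≉0⇒≉[] : ∀ {p} i → coeff p i ≉ 0# → ¬ p ≈ᴾ []
  coeff≉0⇒≉[] i pᵢ≉0 p≈0 = pᵢ≉0 (at p≈0 i)

  degree : ∀ {p} → ¬ p ≈ᴾ [] → ∃ (IsDegree p)
  degree {p} p≉0 with degree? p
  ... | inj₁ p≈0 = contradiction p≈0 p≉0
  ... | inj₂ d   = d

  order : ∀ {p} → ¬ p ≈ᴾ [] → ∃ (IsOrder p)
  order {p} p≉0 with order? p
  ... | inj₁ p≈0 = contradiction p≈0 p≉0
  ... | inj₂ d   = d

  coeff-*-degree-≉0 : ∀ p q {m n} → IsDegree p m → IsDegree q n → coeff (p *ᴾ q) (m ℕ.+ n) ≉ 0#
  coeff-*-degree-≉0 p q {m} {n} (pₘ≉0 , hp) (qₙ≉0 , hq) e =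
    *-≉0 pₘ≉0 qₙ≉0 (trans (sym (coeff-*-top p q m n hp hq)) e)

  coeff-*-order-≉0 : ∀ p q {m n} → IsOrder p m → IsOrder q n → coeff (p *ᴾ q) (m ℕ.+ n) ≉ 0#
  coeff-*-order-≉0 p q {m} {n} (pₘ≉0 , hp) (qₙ≉0 , hq) e =
    *-≉0 pₘ≉0 qₙ≉0 (trans (sym (coeff-*-bottom p q m n hp hq)) e)

  integralᴾ : Integral (R [X])
  integralᴾ p q pq≈0 with degree? p | degree? q
  ... | inj₁ p≈0 | _        = inj₁ p≈0
  ... | inj₂ _   | inj₁ q≈0 = inj₂ q≈0
  ... | inj₂ (m , dp) | inj₂ (n , dq) = contradiction (at pq≈0 (m ℕ.+ n)) (coeff-*-degree-≉0 p q dp dq)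

  -- Degrees add over a domain, and the product `const 1#` has degree 0. This serves for units of
  -- K[x] and, with K[x] as the base ring, of K[x][y].
  unit⇒degree0 : 1# ≉ 0# → ∀ {p n} → p ∣ const 1# → IsDegree p n → n ≡ 0
  unit⇒degree0 1≉0 {p} {n} (q , qp≈1) dp =
    let m , dq = degree {q} λ q≈0 → 1≉0 (trans (sym (at qp≈1 0)) (at (*ᴾ-cong q≈0 (R[X].refl {p})) 0))
        m+n≤0  = IsDegree⇒≤ {const 1#} {0} (1≉0 , λ { (suc i) _ → refl })
                   λ e → coeff-*-degree-≉0 q p dq dp (trans (at qp≈1 (m ℕ.+ n)) e)
    in ℕ.m+n≡0⇒n≡0 m (ℕ.n≤0⇒n≡0 m+n≤0)

  *ᴾ-≉0ˡ : ∀ p q → ¬ p *ᴾ q ≈ᴾ [] → ¬ p ≈ᴾ []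
  *ᴾ-≉0ˡ p q pq≉0 p≈0 = pq≉0 (R[X].trans (R[X].*-congʳ p≈0) (R[X].zeroˡ q))

  *ᴾ-≉0ʳ : ∀ p q → ¬ p *ᴾ q ≈ᴾ [] → ¬ q ≈ᴾ []
  *ᴾ-≉0ʳ p q pq≉0 q≈0 = pq≉0 (R[X].trans (*ᴾ-congˡ p q≈0) (*ᴾ-zeroʳ p))

  monomial-intro : ∀ {p m n} → IsDegree p m → IsOrder p n → n ≡ m → IsMonomial p m
  monomial-intro {p} {m} (pₘ≉0 , above) (_ , below) ≡.refl = pₘ≉0 , away
    where
    away : ∀ i → i ≢ m → coeff p i ≈ 0#
    away i i≢m with ℕ.<-cmp i m
    ... | tri< i<m _ _ = below i i<m
    ... | tri≈ _ i≡m _ = contradiction i≡m i≢m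
    ... | tri> _ _ m<i = above i m<i

  -- The degree and the order of a product are additive and coincide for a
  -- monomial, hence they coincide for both factors.
  monomial-factors : ∀ p q {k} → IsMonomial (p *ᴾ q) k →
    ∃[ m ] ∃[ n ] m ℕ.+ n ≡ k × IsMonomial p m × IsMonomial q n
  monomial-factors p q {k} mono@(pqₖ≉0 , _) =
    let pq≉0    = coeff≉0⇒≉[] {p *ᴾ q} k pqₖ≉0
        p≉0     = *ᴾ-≉0ˡ p q pq≉0
        q≉0     = *ᴾ-≉0ʳ p q pq≉0
        m  , dp = degree p≉0
        n  , dq = degree q≉0
        m′ , op = order p≉0
        n′ , oq = order q≉0
        m+n≡k   = IsMonomial⇒≡ {p *ᴾ q} mono (coeff-*-degree-≉0 p q dp dq)
        m′+n′≡k = IsMonomial⇒≡ {p *ᴾ q} mono (coeff-*-order-≉0 p q op oq)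
        m′≡m , n′≡n = summands-≡ (IsOrder⇒≤ {p} op (proj₁ dp)) (IsOrder⇒≤ {q} oq (proj₁ dq))
                        (≡.trans m+n≡k (≡.sym m′+n′≡k))
    in m , n , m+n≡k , monomial-intro {p} dp op m′≡m , monomial-intro {q} dq oq n′≡n

-- Counting nonunit factors by cancelling primes

-- A factorization into nonunits is never longer than one into primes:
-- cancelling a prime shortens a chain of nonunit factors by at most one.
module NonunitChains (R : CommutativeRing c ℓ) (integral : Integral R) where
  open CommutativeRing R hiding (zero)
  open Factorization R
  open SemiringDivisibility semiring using (_∤_; ∣ʳ-respˡ-≈; ∣ʳ-respʳ-≈; _,_)
  open SemigroupDivisibility *-commutativeSemigroup using (x∣xy; ∣ʳ-trans)
  open CommutativeSemigroupProperties *-commutativeSemigroup using (x∙yz≈y∙xz)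
  open Primality semiring using (Prime; mkPrime)
  open RingProperties ring using (-‿distribʳ-*; x∙y⁻¹≈ε⇒x≈y)
  open SetoidReasoning setoid

  *-cancelˡ-nonZero : ∀ {q x y} → q ≉ 0# → q * x ≈ q * y → x ≈ y
  *-cancelˡ-nonZero {q} {x} {y} q≉0 e with integral q (x - y) (begin
      q * (x - y)       ≈⟨ distribˡ q x (- y) ⟩
      q * x + q * - y   ≈⟨ +-cong e (sym (-‿distribʳ-* q y)) ⟩
      q * y - q * y     ≈⟨ -‿inverseʳ _ ⟩
      0#                ∎)
  ... | inj₁ q≈0   = contradiction q≈0 q≉0
  ... | inj₂ x-y≈0 = x∙y⁻¹≈ε⇒x≈y x y x-y≈0

  -- A chain splits off `m` nonunits and leaves an arbitrary cofactor in `done`. Extra factors can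
  -- thus be absorbed without changing the length, as `Chain-*` does.
  data Chain : ℕ → Carrier → Set (c ⊔ ℓ) where
    done  : ∀ {x} → Chain 0 x
    _∷[_]_ : ∀ {m x r y} → r ∤ 1# → x ≈ r * y → Chain m y → Chain (suc m) x

  Chain-resp : ∀ {m x y} → x ≈ y → Chain m x → Chain m y
  Chain-resp e done            = done
  Chain-resp e (r∤1 ∷[ x≈ ] ch) = r∤1 ∷[ trans (sym e) x≈ ] ch

  Chain-* : ∀ {m x} z → Chain m x → Chain m (z * x)
  Chain-* z done            = done
  Chain-* z (r∤1 ∷[ x≈ ] ch) = r∤1 ∷[ trans (*-congˡ x≈) (x∙yz≈y∙xz _ _ _) ] Chain-* z ch

  -- The prime `q` divides `r * y`. If it divides `r`, then `r` is given up and its quotient by `q`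
  -- is absorbed into the rest of the chain. If it divides `y`, then `r` is kept and `q` is
  -- cancelled further down.
  Chain-cancel : ∀ {m q x} → Prime q → Chain m (q * x) → Chain (pred m) x
  Chain-cancel prime done = done
  Chain-cancel {suc m} {q} {x} prime@(mkPrime q≉0 q∤1 split) (_∷[_]_ {r = r} {y} r∤1 qx≈ry ch)
    with split (∣ʳ-respʳ-≈ qx≈ry (x∣xy q x))
  ... | inj₁ (s , sq≈r) = Chain-resp (sym (*-cancelˡ-nonZero q≉0 (begin
    q * x        ≈⟨ qx≈ry ⟩
    r * y        ≈⟨ *-congʳ sq≈r ⟨
    s * q * y    ≈⟨ *-congʳ (*-comm s q) ⟩
    q * s * y    ≈⟨ *-assoc q s y ⟩
    q * (s * y)  ∎))) (Chain-* s ch)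
  ... | inj₂ (z , zq≈y) = extend (Chain-cancel prime (Chain-resp (trans (sym zq≈y) (*-comm z q)) ch))
    where
    x≈rz : x ≈ r * z
    x≈rz = *-cancelˡ-nonZero q≉0 (begin
      q * x        ≈⟨ qx≈ry ⟩
      r * y        ≈⟨ *-congˡ zq≈y ⟨
      r * (z * q)  ≈⟨ *-assoc r z q ⟨
      r * z * q    ≈⟨ *-comm (r * z) q ⟩
      q * (r * z)  ∎)
    -- Putting `r` in front restores the length lost to `pred`; for length zero, where `pred` loses
    -- nothing, the empty chain is enough.
    extend : ∀ {m} → Chain (pred m) z → Chain m x
    extend {zero}  _   = done
    extend {suc m} ch′ = r∤1 ∷[ x≈rz ] ch′

  -- Induction on `ν`: cancelling the first irreducible factor, which is prime, lowers the factor
  -- count by one and the length of the chain by at most one.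
  Chain≤FactorCount : (∀ {p} → Irreducible p → Prime p) →
    ∀ {m x} ν → HasFactorCount x ν → Chain m x → m ≤ ν
  Chain≤FactorCount prime zero    _ done = z≤n
  -- Here `x` is the unit `u` times the empty product, and a divisor of a unit is a unit.
  Chain≤FactorCount prime zero    (u , ps , u∣1 , _ , x≈u1) (r∤1 ∷[ x≈ry ] _) =
    contradiction (∣ʳ-trans (x∣xy _ _) (∣ʳ-respˡ-≈ (trans (sym (trans x≈u1 (*-identityʳ u))) x≈ry) u∣1)) r∤1
  Chain≤FactorCount prime (suc ν) (u , ps , u∣1 , irr , x≈) ch =
    pred≤⇒≤suc (Chain≤FactorCount prime ν (u , tail ps , u∣1 , irr ∘ suc , refl)
      (Chain-cancel (prime (irr zero)) (Chain-resp (trans x≈ (x∙yz≈y∙xz _ _ _)) ch)))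

-- Transfer of factorizations to leading coefficients

-- f ▷ l is to be read as: l is the leading coefficient of f, in a sense
-- multiplicative enough for factorizations of f to be controlled by those of l.
module LeadingCoefficients (R S : CommutativeRing c ℓ) (em : ExcludedMiddle (c ⊔ ℓ)) (integral : Integral R)
  (_▷_ : CommutativeRing.Carrier S → CommutativeRing.Carrier R → Set ℓ) where
  private
    module R  = CommutativeRing R
    module FR = Factorization R
  open CommutativeRing S hiding (zero)
  open Factorization S
  open NonunitChains R integral using (Chain; done; _∷[_]_; Chain≤FactorCount)
  open SemiringDivisibility semiring using (_∤_; _,_)
  open CommutativeSemigroupProperties *-commutativeSemigroup using (x∙yz≈y∙xz)
  open Primality semiring using (mkIrred)

  IsProduct : Carrier → Set (c ⊔ ℓ)
  IsProduct f = ∃[ m ] ∃[ ps ] (∀ i → Irreducible (ps i)) × f ≈ product {m} ps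

  IsProduct-resp : ∀ {f g} → f ≈ g → IsProduct f → IsProduct g
  IsProduct-resp e (m , ps , irr , f≈) = m , ps , irr , trans (sym e) f≈

  irreducible∤1 : ∀ {f} → Irreducible f → f ∤ 1#
  irreducible∤1 (mkIrred f∤1 _) = f∤1

  -- Excluded middle is applied to the existence of the splitting itself. If there is none, deciding
  -- which factors are units makes `f` irreducible.
  reducible-split : ∀ {f} → f ∤ 1# → ¬ Irreducible f →
    ∃[ g ] ∃[ h ] f ≈ g * h × g ∤ 1# × h ∤ 1#
  reducible-split {f} f∤1 reducible with em {P = ∃[ g ] ∃[ h ] f ≈ g * h × g ∤ 1# × h ∤ 1#}
  ... | yes split = split
  ... | no  none  = contradiction (mkIrred f∤1 λ {g} {h} e → decide g h e em em) reducible
    where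
    decide : ∀ g h → f ≈ g * h → Dec (g ∣ 1#) → Dec (h ∣ 1#) → g ∣ 1# ⊎ h ∣ 1#
    decide g h e (yes g∣1) _         = inj₁ g∣1
    decide g h e (no _)    (yes h∣1) = inj₂ h∣1
    decide g h e (no g∤1)  (no h∤1)  = contradiction (g , h , e , g∤1 , h∤1) none

  module _
    (▷-factors : ∀ {f l} g h → f ≈ g * h → f ▷ l → ∃[ l₁ ] ∃[ l₂ ] g ▷ l₁ × h ▷ l₂ × l R.≈ l₁ R.* l₂)
    (▷-unit : ∀ {f l} → f ▷ l → l FR.∣ R.1# → f ∣ 1#) where

    -- Each irreducible factor contributes one factor of `l`, and this is a nonunit by the
    -- contrapositive of `▷-unit`. The factor `u` travels with the rest and ends up in the cofactor
    -- of the chain.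
    ▷-chain : ∀ m {f l} u ps → f ▷ l → (∀ i → Irreducible (ps i)) → f ≈ u * product {m} ps → Chain m l
    ▷-chain zero    u ps f▷l irr e = done
    ▷-chain (suc m) u ps f▷l irr e
      with ▷-factors (head ps) (u * product (tail ps)) (trans e (x∙yz≈y∙xz u (head ps) (product (tail ps)))) f▷l
    ... | _ , _ , p▷l₁ , rest▷l₂ , l≈ =
      (irreducible∤1 (irr zero) ∘ ▷-unit p▷l₁) ∷[ l≈ ] ▷-chain m u (tail ps) rest▷l₂ (irr ∘ suc) refl

    -- Existence of a factorization, by induction on a bound `k` for the chains of `l`. The
    -- accumulator `y` holds the irreducibles found so far, so that the factorizations of two
    -- factors need not be concatenated.
    *-product : ∀ k {f l y} → f ▷ l → (∀ {m} → Chain m l → m ≤ k) → f ∤ 1# → IsProduct y → IsProduct (f * y)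
    *-product k {f} f▷l bound f∤1 (m , ps , irr , y≈) with em {P = Irreducible f}
    ... | yes f-irr = suc m , (f Vec.∷ ps) , (λ { zero → f-irr ; (suc i) → irr i }) , *-congˡ y≈
    ... | no reducible with reducible-split f∤1 reducible
    ...   | g , h , f≈gh , g∤1 , h∤1 with ▷-factors g h f≈gh f▷l
    -- A proper splitting of `f` already yields a chain of length 1 for `l`.
    *-product zero {f} f▷l bound f∤1 _ | no _ | g , h , f≈gh , g∤1 , h∤1 | _ , _ , g▷l₁ , _ , l≈ =
      contradiction (bound ((g∤1 ∘ ▷-unit g▷l₁) ∷[ l≈ ] done)) λ ()
    *-product (suc k) {f} {y = y} f▷l bound f∤1 py | no _ | g , h , f≈gh , g∤1 , h∤1 | l₁ , l₂ , g▷l₁ , h▷l₂ , l≈ =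
      IsProduct-resp (trans (sym (*-assoc g h y)) (*-congʳ (sym f≈gh)))
        -- A chain of `l₁` becomes a chain of `l` when the nonunit `l₂` is put in front, so the
        -- bound for `l₁` drops by one; the same holds with `l₁` and `l₂` exchanged.
        (*-product k g▷l₁ (λ ch → ℕ.≤-pred (bound ((h∤1 ∘ ▷-unit h▷l₂) ∷[ R.trans l≈ (R.*-comm l₁ l₂) ] ch))) g∤1
        (*-product k h▷l₂ (λ ch → ℕ.≤-pred (bound ((g∤1 ∘ ▷-unit g▷l₁) ∷[ l≈ ] ch))) h∤1 py))

    productOfAtMost : (∀ {p} → FR.Irreducible p → Primality.Prime R.semiring p) →
      ∀ {f l} ν → f ▷ l → f ∤ 1# → FR.HasFactorCount l ν → ProductOfAtMost ν f
    productOfAtMost prime {f} {l} ν f▷l f∤1 count =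
      -- The accumulator starts as the empty product `1#`.
      atMost (IsProduct-resp (*-identityʳ f) (*-product ν f▷l short f∤1 (0 , (λ ()) , (λ ()) , refl)))
      , λ { m (u , ps , _ , irr , f≈) → short (▷-chain m u ps f▷l irr f≈) }
      where
      short : ∀ {m} → Chain m l → m ≤ ν
      short = Chain≤FactorCount prime ν count
      atMost : IsProduct f → ∃[ m ] m ≤ ν × (∃[ ps ] (∀ i → Irreducible (ps i)) × f ≈ product {m} ps)
      atMost (m , ps , irr , f≈) =
        m , short (▷-chain m 1# ps f▷l irr (trans f≈ (sym (*-identityˡ _)))) , ps , irr , f≈

-- Bézout identities and Euclid's lemma

module Bezout (R : CommutativeRing c ℓ) where
  open CommutativeRing R
  open Factorization R
  open SemiringDivisibility semiring using (_,_)
  open SemigroupDivisibility *-commutativeSemigroup using (∣ʳ-trans)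
  open Primality semiring using (Prime; mkPrime; mkIrred; Irreducible⇒≉0)
  open RingProperties ring using (-‿distribˡ-*)
  open CommutativeSemigroupProperties +-commutativeSemigroup using (interchange)
  open SetoidReasoning setoid

  -- A greatest common divisor with its Bézout coefficients: every common divisor of `a` and `b`
  -- divides the combination.
  CombinationDivisor : Carrier → Carrier → Set (c ⊔ ℓ)
  CombinationDivisor a b = ∃[ s ] ∃[ t ] s * a + t * b ∣ a × s * a + t * b ∣ b

  combinationDivisor-zero : ∀ {a} b → a ≈ 0# → CombinationDivisor a b
  combinationDivisor-zero {a} b a≈0 = 0# , 1# , (0# , trans (zeroˡ _) (sym a≈0)) , (1# , (begin
    1# * (0# * a + 1# * b) ≈⟨ *-identityˡ _ ⟩
    0# * a + 1# * b        ≈⟨ +-cong (zeroˡ a) (*-identityˡ b) ⟩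
    0# + b                 ≈⟨ +-identityˡ b ⟩
    b                      ∎))

  -- One step of the extended Euclidean algorithm. The new coefficients come from substituting
  -- `b - q * a` for `r` in `s * r + t * a`.
  combinationDivisor-step : ∀ {a b r} q → b ≈ q * a + r → CombinationDivisor r a → CombinationDivisor a b
  combinationDivisor-step {a} {b} {r} q b≈qa+r (s , t , (x , xd≈r) , (y , yd≈a)) =
    t - s * q , s , (y , trans (*-congˡ same) yd≈a) , (q * y + x , (begin
      (q * y + x) * ((t - s * q) * a + s * b) ≈⟨ *-congˡ same ⟩
      (q * y + x) * (s * r + t * a)           ≈⟨ distribʳ _ _ _ ⟩
      q * y * (s * r + t * a) + x * (s * r + t * a) ≈⟨ +-cong (trans (*-assoc q y _) (*-congˡ yd≈a)) xd≈r ⟩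
      q * a + r                               ≈⟨ b≈qa+r ⟨
      b                                       ∎))
    where
    same : (t - s * q) * a + s * b ≈ s * r + t * a
    same = begin
      (t - s * q) * a + s * b                       ≈⟨ +-cong (distribʳ a t (- (s * q))) (trans (*-congˡ b≈qa+r) (distribˡ s (q * a) r)) ⟩
      (t * a + - (s * q) * a) + (s * (q * a) + s * r) ≈⟨ +-assoc _ _ _ ⟩
      t * a + (- (s * q) * a + (s * (q * a) + s * r)) ≈⟨ +-congˡ (+-assoc _ _ _) ⟨
      t * a + ((- (s * q) * a + s * (q * a)) + s * r) ≈⟨ +-congˡ (+-congʳ cancel) ⟩
      t * a + (0# + s * r)                          ≈⟨ +-congˡ (+-identityˡ _) ⟩
      t * a + s * r                                 ≈⟨ +-comm _ _ ⟩
      s * r + t * a                                 ∎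
      where
      cancel : - (s * q) * a + s * (q * a) ≈ 0#
      cancel = trans (+-cong (sym (-‿distribˡ-* (s * q) a)) (sym (*-assoc s q a))) (-‿inverseˡ _)

  -- Let `d` be the greatest common divisor of `p` and `a`, with `p ≈ x * d`. If `x` is a unit, then
  -- `p` divides `d` and so `a`. If `d` is a unit, multiplying its Bézout identity by `b` exhibits
  -- `b` as a multiple of `p`.
  irreducible⇒prime : ¬ 0# ≈ 1# → (∀ a b → a ≉ 0# → CombinationDivisor a b) →
    ∀ {p} → Irreducible p → Prime p
  irreducible⇒prime 0≉1 bezout {p} irr@(mkIrred p∤1 split) = mkPrime p≉0 p∤1 euclid
    where
    p≉0 : p ≉ 0#
    p≉0 = Irreducible⇒≉0 0≉1 irr
    euclid : ∀ {a b} → p ∣ a * b → p ∣ a ⊎ p ∣ b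
    euclid {a} {b} (e , ep≈ab) with bezout p a p≉0
    ... | s , t , (x , xd≈p) , d∣a with split (sym xd≈p)
    ...   | inj₁ (y , yx≈1) = inj₁ (∣ʳ-trans (y , (begin
      y * p             ≈⟨ *-congˡ xd≈p ⟨
      y * (x * d)       ≈⟨ *-assoc y x d ⟨
      y * x * d         ≈⟨ *-congʳ yx≈1 ⟩
      1# * d            ≈⟨ *-identityˡ d ⟩
      d                 ∎)) d∣a)
      where
      d : Carrier
      d = s * p + t * a
    ...   | inj₂ (y , yd≈1) = inj₂ (y * (s * b + t * e) , (begin
      y * (s * b + t * e) * p             ≈⟨ *-assoc _ _ _ ⟩
      y * ((s * b + t * e) * p)           ≈⟨ *-congˡ (distribʳ p (s * b) (t * e)) ⟩
      y * (s * b * p + t * e * p)         ≈⟨ *-congˡ (+-cong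
        (trans (*-assoc s b p) (trans (*-congˡ (*-comm b p)) (sym (*-assoc s p b))))
        (trans (*-assoc t e p) (trans (*-congˡ ep≈ab) (sym (*-assoc t a b))))) ⟩
      y * (s * p * b + t * a * b)         ≈⟨ *-congˡ (distribʳ b (s * p) (t * a)) ⟨
      y * ((s * p + t * a) * b)           ≈⟨ *-assoc _ _ _ ⟨
      y * (s * p + t * a) * b             ≈⟨ *-congʳ yd≈1 ⟩
      1# * b                              ≈⟨ *-identityˡ b ⟩
      b                                   ∎))

  -- Shaped for division with remainder: `z` is the multiple of the divisor that moves from the
  -- remainder `v` to the quotient part `u`.
  +-borrow : ∀ u v z → u + v ≈ (z + u) + (v - z)
  +-borrow u v z = begin
    u + v             ≈⟨ +-identityˡ _ ⟨
    0# + (u + v)      ≈⟨ +-congʳ (-‿inverseʳ z) ⟨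
    (z - z) + (u + v) ≈⟨ interchange z (- z) u v ⟩
    (z + u) + (- z + v) ≈⟨ +-congˡ (+-comm (- z) v) ⟩
    (z + u) + (v - z) ∎

-- Euclidean division over a field

module FieldPolynomials (K : CommutativeRing c ℓ) (em : ExcludedMiddle (c ⊔ ℓ)) (isField : IsField K) where
  private module K = CommutativeRing K
  open IsField isField
  open Polynomial K

  K-integral : Integral K
  K-integral a b ab≈0 with isZero? em a
  ... | yes a≈0 = inj₁ a≈0
  ... | no  a≉0 = let a⁻¹ , a⁻¹a≈1 , _ = invertible a a≉0 in inj₂ (begin
    b                ≈⟨ K.*-identityˡ b ⟨
    K.1# K.* b       ≈⟨ K.*-congʳ a⁻¹a≈1 ⟨
    a⁻¹ K.* a K.* b  ≈⟨ K.*-assoc _ _ _ ⟩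
    a⁻¹ K.* (a K.* b) ≈⟨ K.*-congˡ ab≈0 ⟩
    a⁻¹ K.* K.0#     ≈⟨ K.zeroʳ _ ⟩
    K.0#             ∎)
    where open SetoidReasoning K.setoid

  open Domain K em K-integral public
  open CommutativeRing (K [X]) hiding (zero)
  open Factorization (K [X])
  open Primality semiring using (Prime)
  open Bezout (K [X]) using (CombinationDivisor; combinationDivisor-zero; combinationDivisor-step; +-borrow)

  1≉0ᴾ : ¬ 1# ≈ 0#
  1≉0ᴾ e = 1≉0 (at e 0)

  ∷-split : ∀ a {p q r} → p ≈ᴾ q +ᴾ r → a ∷ p ≈ᴾ (K.0# ∷ q) +ᴾ (a ∷ r)
  ∷-split a {p} {q} {r} e = ∷-cong (K.sym (K.+-identityˡ a)) e

  -- Recursion on the dividend: a division of `p` gives one of `a ∷ p` with provisional remainder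
  -- `a ∷ r`, of degree at most `n`. Only its coefficient at `n` remains to be removed.
  divMod : ∀ d {n} → IsDegree d n → ∀ p →
    ∃[ q ] ∃[ r ] p ≈ᴾ q *ᴾ d +ᴾ r × VanishesFrom n r
  divMod d _ [] = [] , [] , refl , λ _ _ → K.refl
  divMod d {n} deg@(dₙ≉0 , above) (a ∷ p) with divMod d deg p | invertible _ dₙ≉0
  ... | q , r , p≈qd+r , rAbove | l , ld≈1 , _ = b ∷ q , (a ∷ r) +ᴾ -ᴾ (b · d) , eq , above′
    where
    -- With `l` the inverse of the leading coefficient of `d`, this makes `b · d` agree with `a ∷ r`
    -- at index `n`.
    b : K.Carrier
    b = coeff (a ∷ r) n K.* l
    eq : a ∷ p ≈ (b ∷ q) *ᴾ d +ᴾ ((a ∷ r) +ᴾ -ᴾ (b · d))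
    eq = trans (∷-split a {p} {q *ᴾ d} {r} p≈qd+r) (+-borrow (K.0# ∷ q *ᴾ d) (a ∷ r) (b · d))
    cᵢ : ∀ i → coeff ((a ∷ r) +ᴾ -ᴾ (b · d)) i K.≈ coeff (a ∷ r) i K.+ K.- (b K.* coeff d i)
    cᵢ i = K.trans (coeff-+ (a ∷ r) (-ᴾ (b · d)) i) (K.+-congˡ (K.trans (coeff-neg (b · d) i) (K.-‿cong (coeff-· b d i))))
    bdₙ : b K.* coeff d n K.≈ coeff (a ∷ r) n
    bdₙ = K.trans (K.*-assoc _ _ _) (K.trans (K.*-congˡ ld≈1) (K.*-identityʳ _))
    tailAbove : ∀ i → n < i → coeff (a ∷ r) i K.≈ K.0#
    tailAbove (suc i) (s≤s n≤i) = rAbove i n≤i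
    above′ : VanishesFrom n ((a ∷ r) +ᴾ -ᴾ (b · d))
    above′ i n≤i with ℕ.m≤n⇒m<n∨m≡n n≤i
    ... | inj₁ n<i = K.trans (cᵢ i) (K.trans (K.+-cong (tailAbove i n<i)
            (K.-‿cong (K.trans (K.*-congˡ (above i n<i)) (K.zeroʳ b)))) (K.-‿inverseʳ K.0#))
    ... | inj₂ ≡.refl = K.trans (cᵢ n) (K.trans (K.+-congˡ (K.-‿cong bdₙ)) (K.-‿inverseʳ _))

  -- The Euclidean algorithm, with `n` as a decreasing bound: the remainder vanishes from the degree
  -- of `a` on, which is smaller than the bound for `a`.
  bezout : ∀ n a b → VanishesFrom n a → CombinationDivisor a b
  bezout n a b aAbove with degree? a
  ... | inj₁ a≈0 = combinationDivisor-zero b a≈0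
  bezout zero    a b aAbove | inj₂ (m , aₘ≉0 , _) = contradiction (aAbove m z≤n) aₘ≉0
  bezout (suc n) a b aAbove | inj₂ (m , deg@(aₘ≉0 , _)) with divMod a deg b
  ... | q , r , b≈qa+r , rAbove = combinationDivisor-step {a} {b} {r} q b≈qa+r
    (bezout n r a λ i n≤i → rAbove i (ℕ.≤-trans m≤n n≤i))
    where
    m≤n : m ≤ n
    m≤n = ℕ.≮⇒≥ λ n<m → aₘ≉0 (aAbove m n<m)

  irreducible⇒prime : ∀ {p} → Irreducible p → Prime p
  irreducible⇒prime = Bezout.irreducible⇒prime (K [X]) (1≉0ᴾ ∘ sym)
    λ a b a≉0 → bezout _ a b (proj₂ (proj₂ (degree a≉0)))

-- Leading parts in x of polynomials in K[x][y]

module Dominance (K : CommutativeRing c ℓ) (isField : IsField K) (em : ExcludedMiddle (c ⊔ ℓ)) where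
  private
    module K  = CommutativeRing K
    module X  = FieldPolynomials K em isField
    module PX = Polynomial K
    module Y  = Domain (K [X]) em X.integralᴾ
    module PY = Polynomial (K [X])
    module K[x]   = CommutativeRing (K [X])
    module K[x,y] = CommutativeRing (K [X] [X])
    module Fx  = Factorization (K [X])
    module Fxy = Factorization (K [X] [X])
  open IsField isField using (1≉0)
  open PX using (at; coeffs-≈)
  open SemiringDivisibility K[x,y].semiring using (_,_)
  open SemiringDivisibility K[x].semiring using (∣ʳ-respˡ-≈)

  -- The coefficient of x^N in f, as a polynomial in y.
  slice : ℕ → PY.Poly → PX.Poly
  slice N = map (λ b → PX.coeff b N)

  coeff-slice : ∀ N f i → PX.coeff (slice N f) i ≡ PX.coeff (PY.coeff f i) N
  coeff-slice N []      i       = ≡.refl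
  coeff-slice N (b ∷ f) zero    = ≡.refl
  coeff-slice N (b ∷ f) (suc i) = coeff-slice N f i

  HeightBelow : ℕ → PY.Poly → Set ℓ
  HeightBelow N f = ∀ i → X.VanishesFrom N (PY.coeff f i)

  slice-cong : ∀ {f g} N → f PY.≈ᴾ g → slice N f PX.≈ᴾ slice N g
  slice-cong {f} {g} N e = coeffs-≈ λ i → K.trans (K.reflexive (coeff-slice N f i))
    (K.trans (at (PY.at e i) N) (K.reflexive (≡.sym (coeff-slice N g i))))

  slice-vanish : ∀ {M N f} → HeightBelow M f → M ≤ N → slice N f PX.≈ᴾ []
  slice-vanish {N = N} {f} bound M≤N = coeffs-≈ λ i → K.trans (K.reflexive (coeff-slice N f i)) (bound i N M≤N)

  -- The rule for top coefficients in x, carried through the convolution in y. `M` and `N` are only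
  -- upper bounds for the x-degrees, so a slice may vanish.
  slice-* : ∀ f g M N → HeightBelow (suc M) f → HeightBelow (suc N) g →
    slice (M ℕ.+ N) (f PY.*ᴾ g) PX.≈ᴾ slice M f PX.*ᴾ slice N g
  slice-* []      g M N hf hg = K[x].refl
  slice-* (b ∷ f) g M N hf hg = coeffs-≈ coeffwise
    where
    open SetoidReasoning K.setoid
    bg : ∀ i → PX.coeff (b PX.*ᴾ PY.coeff g i) (M ℕ.+ N) K.≈ PX.coeff b M K.* PX.coeff (slice N g) i
    bg i = K.trans (X.coeff-*-top b (PY.coeff g i) M N (hf 0) (hg i))
      (K.*-congˡ (K.reflexive (≡.sym (coeff-slice N g i))))
    coeffwise : ∀ i → PX.coeff (slice (M ℕ.+ N) ((b ∷ f) PY.*ᴾ g)) i K.≈ PX.coeff (slice M (b ∷ f) PX.*ᴾ slice N g) i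
    coeffwise zero = begin
      PX.coeff (slice (M ℕ.+ N) ((b ∷ f) PY.*ᴾ g)) 0            ≡⟨ coeff-slice (M ℕ.+ N) ((b ∷ f) PY.*ᴾ g) 0 ⟩
      PX.coeff (PY.coeff ((b ∷ f) PY.*ᴾ g) 0) (M ℕ.+ N)         ≈⟨ at (Y.coeff-*-zero b f g) (M ℕ.+ N) ⟩
      PX.coeff (b PX.*ᴾ PY.coeff g 0) (M ℕ.+ N)                 ≈⟨ bg 0 ⟩
      PX.coeff b M K.* PX.coeff (slice N g) 0                   ≈⟨ X.coeff-*-zero (PX.coeff b M) (slice M f) (slice N g) ⟨
      PX.coeff (slice M (b ∷ f) PX.*ᴾ slice N g) 0              ∎
    coeffwise (suc i) = begin
      PX.coeff (slice (M ℕ.+ N) ((b ∷ f) PY.*ᴾ g)) (suc i)      ≡⟨ coeff-slice (M ℕ.+ N) ((b ∷ f) PY.*ᴾ g) (suc i) ⟩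
      PX.coeff (PY.coeff ((b ∷ f) PY.*ᴾ g) (suc i)) (M ℕ.+ N)   ≈⟨ at (Y.coeff-*-suc b f g i) (M ℕ.+ N) ⟩
      PX.coeff (b PX.*ᴾ PY.coeff g (suc i) PX.+ᴾ PY.coeff (f PY.*ᴾ g) i) (M ℕ.+ N)
        ≈⟨ PX.coeff-+ (b PX.*ᴾ PY.coeff g (suc i)) (PY.coeff (f PY.*ᴾ g) i) (M ℕ.+ N) ⟩
      PX.coeff (b PX.*ᴾ PY.coeff g (suc i)) (M ℕ.+ N) K.+ PX.coeff (PY.coeff (f PY.*ᴾ g) i) (M ℕ.+ N)
        ≈⟨ K.+-cong (bg (suc i)) (K.trans (K.reflexive (≡.sym (coeff-slice (M ℕ.+ N) (f PY.*ᴾ g) i)))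
             (at (slice-* f g M N (hf ∘ suc) hg) i)) ⟩
      PX.coeff b M K.* PX.coeff (slice N g) (suc i) K.+ PX.coeff (slice M f PX.*ᴾ slice N g) i
        ≈⟨ X.coeff-*-suc (PX.coeff b M) (slice M f) (slice N g) i ⟨
      PX.coeff (slice M (b ∷ f) PX.*ᴾ slice N g) (suc i)        ∎

  IsHeight : PY.Poly → ℕ → Set ℓ
  IsHeight f N = HeightBelow (suc N) f × ¬ slice N f PX.≈ᴾ []

  heightBelow : ∀ f → ∃[ N ] HeightBelow N f
  heightBelow []      = 0 , λ _ _ _ → K.refl
  heightBelow (b ∷ f) with X.degree? b | heightBelow f
  ... | inj₁ b≈0 | N , hf = N , λ { zero i _ → at b≈0 i ; (suc j) → hf j }
  ... | inj₂ (d , _ , hb) | N , hf = suc d ℕ.⊔ N , λ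
    { zero    i le → hb i (ℕ.m⊔n≤o⇒m≤o (suc d) N le)
    ; (suc j) i le → hf j i (ℕ.m⊔n≤o⇒n≤o (suc d) N le) }

  -- Any bound on the x-degree is lowered until the slice just below it is nonzero.
  height : ∀ {f} → ¬ f PY.≈ᴾ [] → ∃ (IsHeight f)
  height {f} f≉0 = let N , hf = heightBelow f in descend N hf
    where
    descend : ∀ N → HeightBelow N f → ∃ (IsHeight f)
    descend zero    hf = contradiction (PY.coeffs-≈ λ i → coeffs-≈ λ j → hf i j z≤n) f≉0
    descend (suc N) hf with Polynomial.isZero? (K [X]) em (slice N f)
    ... | no  fₙ≉0 = N , hf , fₙ≉0
    ... | yes fₙ≈0 = descend N λ i j N≤j → below i j (ℕ.m≤n⇒m<n∨m≡n N≤j)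
      where
      below : ∀ i j → N < j ⊎ N ≡ j → PX.coeff (PY.coeff f i) j K.≈ K.0#
      below i j (inj₁ N<j)    = hf i j N<j
      below i j (inj₂ ≡.refl) = K.trans (K.reflexive (≡.sym (coeff-slice N f i))) (at fₙ≈0 i)

  -- Dominated polynomials and their factors

  -- n = 0 is the situation of (i) and n = deg_y f that of (ii): the x-leading
  -- part of f is a monomial in y of that degree.
  record Dominated (n : ℕ) (f : PY.Poly) : Set ℓ where
    field
      top       : ℕ
      bounded   : HeightBelow (suc top) f
      monomial  : X.IsMonomial (slice top f) n
      extremal  : n ≡ 0 ⊎ Y.VanishesFrom (suc n) f
      constant≉0 : ¬ PY.coeff f 0 PX.≈ᴾ []

    ≉0 : ¬ f PY.≈ᴾ []
    ≉0 f≈0 = constant≉0 (PY.at f≈0 0)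

    lead-degree : X.IsDegree (PY.coeff f n) top
    lead-degree = (λ e → proj₁ monomial (K.trans (K.reflexive (coeff-slice top f n)) e)) , bounded n

  Dominated-resp : ∀ {n f g} → f PY.≈ᴾ g → Dominated n f → Dominated n g
  Dominated-resp {n} {f} {g} e D = record
    { top        = top
    ; bounded    = λ i j le → K.trans (K.sym (at (PY.at e i) j)) (bounded i j le)
    ; monomial   = X.IsMonomial-resp (slice-cong top e) monomial
    ; extremal   = extremal′ extremal
    ; constant≉0 = constant≉0 ∘ K[x].trans (PY.at e 0)
    }
    where
    open Dominated D
    extremal′ : n ≡ 0 ⊎ Y.VanishesFrom (suc n) f → n ≡ 0 ⊎ Y.VanishesFrom (suc n) g
    extremal′ (inj₁ n≡0) = inj₁ n≡0
    extremal′ (inj₂ v)   = inj₂ λ i le → K[x].trans (K[x].sym (PY.at e i)) (v i le)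

  -- Below `M ℕ.+ N`, `top` would force the product of two nonzero slices to vanish. Above it, the
  -- slice at `top` would be zero and not a monomial.
  top-additive : ∀ {n} g h {M N} (D : Dominated n (g PY.*ᴾ h)) → IsHeight g M → IsHeight h N →
    Dominated.top D ≡ M ℕ.+ N
  top-additive {n} g h {M} {N} D (hg , gₘ≉0) (hh , hₙ≉0) with ℕ.<-cmp (Dominated.top D) (M ℕ.+ N)
  ... | tri≈ _ eq _ = eq
  ... | tri< lt _ _ = ⊥-elim (Y.*-≉0 gₘ≉0 hₙ≉0
        (K[x].trans (K[x].sym (slice-* g h M N hg hh)) (slice-vanish {f = g PY.*ᴾ h} (Dominated.bounded D) lt)))
  ... | tri> _ _ gt = ⊥-elim (X.coeff≉0⇒≉[] n (proj₁ (Dominated.monomial D)) vanish)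
    where
    -- Writing `top` as `M ℕ.+ N′` with `N′` above the height of `h` lets `slice-*` produce a
    -- vanishing factor.
    top N′ : ℕ
    top = Dominated.top D
    N′ = top ℕ.∸ M
    M≤top : M ≤ top
    M≤top = ℕ.≤-trans (ℕ.m≤m+n M N) (ℕ.<⇒≤ gt)
    N<N′ : N < N′
    N<N′ = ℕ.+-cancelˡ-< M N N′ (≡.subst (M ℕ.+ N <_) (≡.sym (ℕ.m+[n∸m]≡n M≤top)) gt)
    vanish : slice top (g PY.*ᴾ h) PX.≈ᴾ []
    vanish = ≡.subst (λ k → slice k (g PY.*ᴾ h) PX.≈ᴾ []) (ℕ.m+[n∸m]≡n M≤top)
      (K[x].trans (slice-* g h M N′ hg λ i j le → hh i j (ℕ.≤-trans (s≤s (ℕ.<⇒≤ N<N′)) le))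
      (K[x].trans (PX.*ᴾ-congˡ (slice M g) (slice-vanish {f = h} hh N<N′)) (PX.*ᴾ-zeroʳ (slice M g))))

  slice-factors : ∀ {n} g h {M N} → Dominated n (g PY.*ᴾ h) → IsHeight g M → IsHeight h N →
    ∃[ p ] ∃[ q ] p ℕ.+ q ≡ n × X.IsMonomial (slice M g) p × X.IsMonomial (slice N h) q
  slice-factors {n} g h {M} {N} D hg hh = X.monomial-factors (slice M g) (slice N h)
    (X.IsMonomial-resp (slice-* g h M N (proj₁ hg) (proj₁ hh))
      (≡.subst (λ k → X.IsMonomial (slice k (g PY.*ᴾ h)) n) (top-additive g h D hg hh) (Dominated.monomial D)))

  Dominated-assemble : ∀ {n} g h {M N p q} → Dominated n (g PY.*ᴾ h) → IsHeight g M → IsHeight h N →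
    p ℕ.+ q ≡ n → X.IsMonomial (slice M g) p → X.IsMonomial (slice N h) q →
    Dominated p g × Dominated q h × PY.coeff (g PY.*ᴾ h) n PX.≈ᴾ PY.coeff g p PX.*ᴾ PY.coeff h q
  Dominated-assemble g h {M} {N} {p} {q} D (gBound , _) (hBound , _) ≡.refl gMono hMono =
      record { top = M ; bounded = gBound ; monomial = gMono ; extremal = proj₁ ext ; constant≉0 = g₀≉0 }
    , record { top = N ; bounded = hBound ; monomial = hMono ; extremal = proj₁ (proj₂ ext) ; constant≉0 = h₀≉0 }
    , proj₂ (proj₂ ext)
    where
    constant : PY.coeff (g PY.*ᴾ h) 0 PX.≈ᴾ PY.coeff g 0 PX.*ᴾ PY.coeff h 0
    constant = Y.coeff-*-bottom g h 0 0 (λ _ ()) (λ _ ())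
    constant≉0 : ¬ PY.coeff g 0 PX.*ᴾ PY.coeff h 0 PX.≈ᴾ []
    constant≉0 = Dominated.constant≉0 D ∘ K[x].trans constant
    g₀≉0 : ¬ PY.coeff g 0 PX.≈ᴾ []
    g₀≉0 = X.*ᴾ-≉0ˡ (PY.coeff g 0) (PY.coeff h 0) constant≉0
    h₀≉0 : ¬ PY.coeff h 0 PX.≈ᴾ []
    h₀≉0 = X.*ᴾ-≉0ʳ (PY.coeff g 0) (PY.coeff h 0) constant≉0
    lead≉0 : ∀ f {m L} → X.IsMonomial (slice L f) m → ¬ PY.coeff f m PX.≈ᴾ []
    lead≉0 f {m} {L} (e , _) f≈0 = e (K.trans (K.reflexive (coeff-slice L f m)) (at f≈0 L))
    Goal : Set ℓ
    Goal = (p ≡ 0 ⊎ Y.VanishesFrom (suc p) g) × (q ≡ 0 ⊎ Y.VanishesFrom (suc q) h)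
      × PY.coeff (g PY.*ᴾ h) (p ℕ.+ q) PX.≈ᴾ PY.coeff g p PX.*ᴾ PY.coeff h q
    atZero : ∀ {p q} → p ≡ 0 → q ≡ 0 →
      PY.coeff (g PY.*ᴾ h) (p ℕ.+ q) PX.≈ᴾ PY.coeff g p PX.*ᴾ PY.coeff h q
    atZero ≡.refl ≡.refl = constant
    ext : Goal
    -- At an inner exponent the coefficient of the product could be a sum of several products. At an
    -- extreme one, `p` and `q` are extreme for `g` and `h`, and a single product remains.
    ext with Dominated.extremal D
    ... | inj₁ p+q≡0 = inj₁ p≡0 , inj₁ q≡0 , atZero p≡0 q≡0
      where
      p≡0 : p ≡ 0
      p≡0 = ℕ.m+n≡0⇒m≡0 p p+q≡0
      q≡0 : q ≡ 0
      q≡0 = ℕ.m+n≡0⇒n≡0 p p+q≡0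
    ... | inj₂ v =
      let p′ , dg = Y.degree {g} (Y.*ᴾ-≉0ˡ g h (Dominated.≉0 D))
          q′ , dh = Y.degree {h} (Y.*ᴾ-≉0ʳ g h (Dominated.≉0 D))
          p≤p′ = Y.IsDegree⇒≤ {g} dg (lead≉0 g gMono)
          q≤q′ = Y.IsDegree⇒≤ {h} dh (lead≉0 h hMono)
          -- The y-degrees add up to an index where the product has a nonzero coefficient, so they
          -- cannot exceed `p` and `q`.
          p′+q′≤p+q = ℕ.≮⇒≥ λ lt → Y.coeff-*-degree-≉0 g h dg dh (v _ lt)
          p≡p′ , q≡q′ = summands-≡ p≤p′ q≤q′ (ℕ.≤-antisym p′+q′≤p+q (ℕ.+-mono-≤ p≤p′ q≤q′))
          vg = ≡.subst (λ k → Y.VanishesFrom (suc k) g) (≡.sym p≡p′) (proj₂ dg)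
          vh = ≡.subst (λ k → Y.VanishesFrom (suc k) h) (≡.sym q≡q′) (proj₂ dh)
      in inj₂ vg , inj₂ vh , Y.coeff-*-top g h p q vg vh

  Dominated-factors : ∀ {n} g h → Dominated n (g PY.*ᴾ h) →
    ∃[ p ] ∃[ q ] Dominated p g × Dominated q h ×
      PY.coeff (g PY.*ᴾ h) n PX.≈ᴾ PY.coeff g p PX.*ᴾ PY.coeff h q
  Dominated-factors g h D =
    let M , hg = height (Y.*ᴾ-≉0ˡ g h (Dominated.≉0 D))
        N , hh = height (Y.*ᴾ-≉0ʳ g h (Dominated.≉0 D))
        p , q , p+q≡n , gMono , hMono = slice-factors g h D hg hh
    in p , q , Dominated-assemble g h D hg hh p+q≡n gMono hMono

  Dominated-unit : ∀ {n f} → Dominated n f → PY.coeff f n Fx.∣ K[x].1# → f Fxy.∣ K[x,y].1#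
  Dominated-unit {n} {f} D lead∣1 = unit
    where
    open Dominated D
    top≡0 : top ≡ 0
    top≡0 = X.unit⇒degree0 1≉0 {PY.coeff f n} lead∣1 lead-degree
    -- As `top` is 0, every coefficient is constant in x, and the slice at 0 determines all of `f`.
    off : ∀ i → i ≢ n → PY.coeff f i PX.≈ᴾ []
    off i i≢n = coeffs-≈ λ
      { zero    → K.trans (≡.subst (λ k → PX.coeff (PY.coeff f i) 0 K.≈ PX.coeff (PY.coeff f i) k) (≡.sym top≡0) K.refl)
                    (K.trans (K.reflexive (≡.sym (coeff-slice top f i))) (proj₂ monomial i i≢n))
      ; (suc j) → bounded i (suc j) (≡.subst (λ k → suc k ≤ suc j) (≡.sym top≡0) (s≤s z≤n)) }
    n≡0 : n ≡ 0
    n≡0 with n ℕ.≟ 0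
    ... | yes n≡0 = n≡0
    -- A monomial in y of positive degree has zero constant term.
    ... | no  n≢0 = contradiction (off 0 (n≢0 ∘ ≡.sym)) constant≉0
    unit : f Fxy.∣ K[x,y].1#
    unit with ≡.subst (λ k → PY.coeff f k Fx.∣ K[x].1#) n≡0 lead∣1
    ... | record { quotient = q ; equality = qf₀≈1 } = PY.const q , PY.coeffs-≈ λ
      { zero    → K[x].trans (Y.coeff-*-zero q [] f) qf₀≈1
      ; (suc i) → K[x].trans (Y.coeff-*-suc q [] f i) (K[x].trans (K[x].+-identityʳ _)
          (K[x].trans (PX.*ᴾ-congˡ q (off (suc i) λ e → ℕ.0≢1+n (≡.trans (≡.sym n≡0) (≡.sym e)))) (PX.*ᴾ-zeroʳ q))) }

  -- The exponent is quantified away because it changes from `f` to its factors, whose exponents add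
  -- up to `n`.
  _▷_ : PY.Poly → PX.Poly → Set ℓ
  f ▷ l = ∃[ n ] Dominated n f × PY.coeff f n PX.≈ᴾ l

  ▷-factors : ∀ {f l} g h → f PY.≈ᴾ g PY.*ᴾ h → f ▷ l →
    ∃[ l₁ ] ∃[ l₂ ] g ▷ l₁ × h ▷ l₂ × l PX.≈ᴾ l₁ PX.*ᴾ l₂
  ▷-factors g h f≈gh (n , D , fₙ≈l) =
    let p , q , Dg , Dh , eq = Dominated-factors g h (Dominated-resp f≈gh D)
    in PY.coeff g p , PY.coeff h q , (p , Dg , K[x].refl) , (q , Dh , K[x].refl)
      , K[x].trans (K[x].sym fₙ≈l) (K[x].trans (PY.at f≈gh n) eq)

  ▷-unit : ∀ {f l} → f ▷ l → l Fx.∣ K[x].1# → f Fxy.∣ K[x,y].1#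
  ▷-unit (n , D , fₙ≈l) l∣1 = Dominated-unit D (∣ʳ-respˡ-≈ (K[x].sym fₙ≈l) l∣1)

  ▷⇒productOfAtMost : ∀ {f l} ν → f ▷ l → ¬ f Fxy.∣ K[x,y].1# → Fx.HasFactorCount l ν → Fxy.ProductOfAtMost ν f
  ▷⇒productOfAtMost = LeadingCoefficients.productOfAtMost (K [X]) (K [X] [X]) em X.integralᴾ _▷_
    ▷-factors ▷-unit X.irreducible⇒prime

  -- From the degree hypotheses to domination

  Dominated-intro : ∀ {n f N} → X.IsDegree (PY.coeff f n) N →
    (∀ i → i ≢ n → X.VanishesFrom N (PY.coeff f i)) →
    n ≡ 0 ⊎ Y.VanishesFrom (suc n) f → ¬ PY.coeff f 0 PX.≈ᴾ [] → Dominated n f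
  Dominated-intro {n} {f} {N} (lead≉0 , leadAbove) others extremal f₀≉0 = record
    { top        = N
    ; bounded    = bounded
    ; monomial   = (λ e → lead≉0 (K.trans (K.reflexive (≡.sym (coeff-slice N f n))) e))
                 , λ i i≢n → K.trans (K.reflexive (coeff-slice N f i)) (others i i≢n N ℕ.≤-refl)
    ; extremal   = extremal
    ; constant≉0 = f₀≉0
    }
    where
    bounded : HeightBelow (suc N) f
    bounded i with i ℕ.≟ n
    ... | yes ≡.refl = leadAbove
    ... | no  i≢n    = λ j N<j → others i i≢n j (ℕ.<⇒≤ N<j)

  module _ {n} (0<n : 0 < n) (a : Vector PX.Poly (suc n)) (ends≉0 : ¬ head a PX.*ᴾ last a PX.≈ᴾ []) where

    head≉0 : ¬ head a PX.≈ᴾ []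
    head≉0 = X.*ᴾ-≉0ˡ (head a) (last a) ends≉0

    isDegree : Y.IsDegree (toList a) n
    isDegree = ≡.subst (λ b → ¬ b PX.≈ᴾ []) (≡.sym (Y.coeff-toList-last a)) (X.*ᴾ-≉0ʳ (head a) (last a) ends≉0)
             , Y.toList-vanishes a

    -- The y-degree of `f` is the positive number `n`, while units have y-degree 0.
    nonunit : ¬ toList a Fxy.∣ K[x,y].1#
    nonunit f∣1 = ℕ.<⇒≢ 0<n (≡.sym (Y.unit⇒degree0 X.1≉0ᴾ f∣1 isDegree))

    head-dominates : maximum (PX.deg em ∘ tail a) <ᵈ PX.deg em (head a) → toList a ▷ head a
    head-dominates max< =
      let N , headDegree , small = X.maximum-deg (tail a) (head a) max<
      in 0 , Dominated-intro headDegree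
           (λ { zero 0≢0 → contradiction ≡.refl 0≢0
              ; (suc i) _ → Y.coeff-toList {P = X.VanishesFrom N} (tail a) (λ _ _ → K.refl) small i })
           (inj₁ ≡.refl) head≉0 , K[x].refl

    last-dominates : maximum (PX.deg em ∘ init a) <ᵈ PX.deg em (last a) → toList a ▷ last a
    last-dominates max< =
      let N , lastDegree , small = X.maximum-deg (init a) (last a) max<
      in n , Dominated-intro (≡.subst (λ b → X.IsDegree b N) (≡.sym (Y.coeff-toList-last a)) lastDegree)
           (Y.coeff-toList-init {P = X.VanishesFrom N} a (λ _ _ → K.refl) small)
           (inj₂ (Y.toList-vanishes a)) head≉0 , K[x].reflexive (Y.coeff-toList-last a)

theorem1 :
  ∀ {c ℓ} (em : ExcludedMiddle (c ⊔ ℓ)) (K : CommutativeRing c ℓ) → IsField K →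
  let module K[x] = CommutativeRing (K [X])
      module Fx   = Factorization (K [X])
      module Fxy  = Factorization (K [X] [X])
  in
  (n : ℕ) → 2 ≤ n →
  (a : Vector K[x].Carrier (suc n)) → ¬ (head a K[x].* last a K[x].≈ K[x].0#) →
  let f = toList a in
  (∀ g → Polynomial.Nonconstant K em g → ¬ (Polynomial.const (K [X]) g Fxy.∣ f)) →
  (ν₀ νₙ : ℕ) → Fx.HasFactorCount (head a) ν₀ → Fx.HasFactorCount (last a) νₙ →
  (maximum (Polynomial.deg K em ∘ tail a) <ᵈ Polynomial.deg K em (head a) → Fxy.ProductOfAtMost ν₀ f)
  ×
  (maximum (Polynomial.deg K em ∘ init a) <ᵈ Polynomial.deg K em (last a) → Fxy.ProductOfAtMost νₙ f)
theorem1 em K isField n 2≤n a ends≉0 _ ν₀ νₙ count₀ countₙ =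
    (λ max< → ▷⇒productOfAtMost ν₀ (head-dominates 0<n a ends≉0 max<) (nonunit 0<n a ends≉0) count₀)
  , (λ max< → ▷⇒productOfAtMost νₙ (last-dominates 0<n a ends≉0 max<) (nonunit 0<n a ends≉0) countₙ)
  where
  open Dominance K isField em
  0<n : 0 < n
  0<n = ℕ.<⇒≤ 2≤n
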